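{- For every wqo $A$ there exists $m\in\mathbb{N}$ such that $$1+\mathbf{h}(A)\;\le\;\mathbf{h}(\mathcal{P}_f(A))\;\le\;\begin{cases}2^{\mathbf{h}(A)} & \text{if } \mathbf{h}(A) \text{ is a limit ordinal},\\ 2^{\mathbf{h}(A)}\cdot m & \text{if } \mathbf{h}(A)\text{ is a successor ordinal.}\end{cases}$$
   Context: A quasi-order $(A,\le)$ is a well-quasi-order (wqo) if every infinite sequence $x_0,x_1,\dots$ in $A$ has indices $i<j$ with $x_i\le x_j$. For a wqo $A$, let $\mathrm{Bad}(A)$, $\mathrm{Dec}(A)$, $\mathrm{Inco}(A)$ be the trees of finite bad sequences (sequences with no $i<j$, $x_i\le x_j$), finite strictly decreasing sequences, and finite sequences of pairwise incomparable elements of $A$, respectively; the root is the empty sequence and the children of a sequence are its one-element extensions. These trees are well-founded; the rank of a node $s$ is $r(s)=\sup\{r(t)+1 : t \text{ a child of } s\}$. The maximal order type $\mathbf{o}(A)$, height $\mathbf{h}(A)$ and width $\mathbf{w}(A)$ are the ranks of the roots of $\mathrm{Bad}(A)$, $\mathrm{Dec}(A)$, $\mathrm{Inco}(A)$ respectively. $\mathcal{P}_f(A)$ denotes the set of finite subsets of $A$ ordered by the Hoare embedding: $S\le_H S'$ iff for every $a\in S$ there is $b\in S'$ with $a\le b$. Ordinal arithmetic (sum, product, exponentiation) is the usual one. -}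

module Defs where

open import Axiom.ExcludedMiddle using (ExcludedMiddle)
open import Data.Empty using (⊥; ⊥-elim)
open import Data.List.Base using (List; []; _∷_)
import Data.List.Relation.Binary.Subset.Setoid as Subset
open import Data.List.Relation.Unary.All as All using (All; []; _∷_)
open import Data.List.Relation.Unary.Any as Any using (Any; here; there)
open import Data.List.Relation.Unary.Linked using (Linked; _∷_)
open import Data.Nat.Base as ℕ using (ℕ; zero; suc; s≤s; z≤n)
import Data.Nat.Properties as ℕₚ
open import Data.Product using (Σ; ∃; ∃₂; _×_; _,_; proj₁; proj₂)
open import Data.Sum.Base using (_⊎_; inj₁; inj₂; [_,_]′)
open import Data.Unit.Polymorphic.Base using (⊤)
open import Data.Empty.Polymorphic using () renaming (⊥ to ⊥ₚ; ⊥-elim to ⊥ₚ-elim)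
open import Function.Base using (id; _∘_)
open import Induction.WellFounded using (Acc; acc)
open import Level as L using (Level; _⊔_)
open import Relation.Binary.Bundles using (Preorder)
open import Relation.Binary.Core using (Rel)
open import Relation.Binary.PropositionalEquality using (_≡_; refl; subst)
open import Relation.Nullary using (yes; no; ¬_)
open import Relation.Unary using (Pred)

private
  variable
    a p c ℓ ℓ₁ ℓ₂ : Level

------------------------------------------------------------------------
-- Ordinals
--
-- sup⁺ I f denotes the ordinal sup { f i + 1 ∣ i ∈ I }, i.e. the least
-- ordinal strictly above every f i.  The family f need not be monotone,
-- and one ordinal has many representations, so equality of ordinals
-- is _≈ₒ_ and not _≡_.

data Ord ℓ : Set (L.suc ℓ) where
  sup⁺ : (I : Set ℓ) → (I → Ord ℓ) → Ord ℓ

infix 4 _≤ₒ_ _<ₒ_ _≈ₒ_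

mutual
  _≤ₒ_ : Ord ℓ → Ord ℓ → Set ℓ
  sup⁺ I f ≤ₒ β = (i : I) → f i <ₒ β

  _<ₒ_ : Ord ℓ → Ord ℓ → Set ℓ
  α <ₒ sup⁺ J g = Σ J λ j → α ≤ₒ g j

_≈ₒ_ : Ord ℓ → Ord ℓ → Set ℓ
α ≈ₒ β = (α ≤ₒ β) × (β ≤ₒ α)

zeroₒ : Ord ℓ
zeroₒ = sup⁺ ⊥ₚ ⊥ₚ-elim

sucₒ : Ord ℓ → Ord ℓ
sucₒ α = sup⁺ ⊤ λ _ → α

oneₒ : Ord ℓ
oneₒ = sucₒ zeroₒ

fromℕ : ℕ → Ord ℓ
fromℕ zero    = zeroₒ
fromℕ (suc n) = sucₒ (fromℕ n)

Index : Ord ℓ → Set ℓ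
Index (sup⁺ I _) = I

below : (α : Ord ℓ) → Index α → Ord ℓ
below (sup⁺ _ f) = f

-- Least upper bounds (no successor taken).

⨆ : (I : Set ℓ) → (I → Ord ℓ) → Ord ℓ
⨆ I f = sup⁺ (Σ I (Index ∘ f)) λ (i , k) → below (f i) k

maxₒ : Ord ℓ → Ord ℓ → Ord ℓ
maxₒ α β = sup⁺ (Index α ⊎ Index β) [ below α , below β ]′

-- The zero, successor and limit clauses of ordinal arithmetic are merged:
--   α + β = max (α , sup { (α + γ) + 1 ∣ γ < β })
--   α · β = sup { α · γ + α ∣ γ < β }
--   2 ^ β = max (1 , sup { 2 ^ γ · 2 ∣ γ < β })
-- As the expressions under each sup are monotone in γ, letting γ range
-- over the family representing β rather than over all γ < β makes no
-- difference.

infixl 6 _+ₒ_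
infixl 7 _·ₒ_
infixr 8 2^_

_+ₒ_ : Ord ℓ → Ord ℓ → Ord ℓ
α +ₒ sup⁺ J g = maxₒ α (sup⁺ J λ j → α +ₒ g j)

_·ₒ_ : Ord ℓ → Ord ℓ → Ord ℓ
α ·ₒ sup⁺ J g = ⨆ J λ j → α ·ₒ g j +ₒ α

2^_ : Ord ℓ → Ord ℓ
2^ (sup⁺ J g) = maxₒ oneₒ (⨆ J λ j → 2^ (g j) ·ₒ fromℕ 2)

IsSuccessor : Ord ℓ → Set (L.suc ℓ)
IsSuccessor α = ∃ λ β → α ≈ₒ sucₒ β

-- Zero counts as a limit ordinal, so that every ordinal is
-- either a successor or a limit.

IsLimit : Ord ℓ → Set (L.suc ℓ)
IsLimit α = ¬ IsSuccessor α

------------------------------------------------------------------------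
-- Trees of finite sequences
--
-- A sequence x₀, …, xₙ is stored last element first, as
-- xₙ ∷ … ∷ x₀ ∷ [], so the one-element extensions of s are the x ∷ s.

module Tree {A : Set a} (T : Pred (List A) p) where

  _ChildOf_ : Rel (List A) (a ⊔ p)
  t ChildOf s = ∃ λ x → t ≡ x ∷ s × T t

  rank : ∀ {s} → Acc _ChildOf_ s → Ord (a ⊔ p)
  rank {s} (acc rs) = sup⁺ (∃ λ x → T (x ∷ s)) λ (x , t) → rank (rs (x , refl , t))

------------------------------------------------------------------------
-- Well-quasi-orders and their heights

module _ (A : Preorder c ℓ₁ ℓ₂) where
  open Preorder A using (Carrier; _≲_)

  IsWQO : Set (c ⊔ ℓ₂)
  IsWQO = (x : ℕ → Carrier) → ∃₂ λ i j → i ℕ.< j × x i ≲ x j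

  Strict : Rel Carrier ℓ₂
  Strict x y = x ≲ y × ¬ (y ≲ x)

  -- Linked relates each stored element to the one stored after it,
  -- i.e. to its predecessor in the sequence.

  Decreasing : Pred (List Carrier) (c ⊔ ℓ₂)
  Decreasing = Linked Strict

  open Tree Decreasing

  -- Excluded middle is needed to turn the absence of infinite bad
  -- sequences into well-foundedness.  It yields elements of Σ-types, so no
  -- separate axiom of dependent choice is required.

  private
    strict-trans : ∀ {x y z} → Strict x y → Strict y z → Strict x z
    strict-trans (xy , ¬yx) (yz , ¬zy) =
      Preorder.trans A xy yz , λ zx → ¬yx (Preorder.trans A yz zx)

    descends : (f : ℕ → Carrier) → (∀ n → Strict (f (suc n)) (f n)) →
               ∀ {i j} → i ℕ.<′ j → Strict (f j) (f i)
    descends f d (ℕ.<′-base)   = d _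
    descends f d (ℕ.<′-step q) = strict-trans (d _) (descends f d q)

  module _ (em : ExcludedMiddle (c ⊔ ℓ₂)) (wqo : IsWQO) where

    private
      Node : Set (c ⊔ ℓ₂)
      Node = ∃₂ λ x s → Decreasing (x ∷ s) × ¬ Acc _ChildOf_ (x ∷ s)

      escape : ∀ s → ¬ Acc _ChildOf_ s →
               ∃ λ x → Decreasing (x ∷ s) × ¬ Acc _ChildOf_ (x ∷ s)
      escape s ¬acc
        with em {∃ λ x → Decreasing (x ∷ s) × ¬ Acc _ChildOf_ (x ∷ s)}
      ... | yes e = e
      ... | no ¬e = ⊥-elim (¬acc (acc rs))
        where
        rs : ∀ {t} → t ChildOf s → Acc _ChildOf_ t
        rs {t} (x , refl , d) with em {Acc _ChildOf_ t}
        ... | yes q = q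
        ... | no ¬q = ⊥-elim (¬e (x , d , ¬q))

      step : Node → Node
      step (x , s , d , ¬acc) with escape (x ∷ s) ¬acc
      ... | y , d′ , ¬acc′ = y , x ∷ s , d′ , ¬acc′

      step-strict : ∀ n → Strict (proj₁ (step n)) (proj₁ n)
      step-strict (x , s , d , ¬acc) with escape (x ∷ s) ¬acc
      ... | y , (y<x ∷ _) , _ = y<x

      path : Node → ℕ → Node
      path n₀ zero    = n₀
      path n₀ (suc n) = step (path n₀ n)

      no-path : Node → ⊥
      no-path n₀ with wqo (proj₁ ∘ path n₀)
      ... | i , j , i<j , xᵢ≲xⱼ =
        proj₂ (descends (proj₁ ∘ path n₀) (step-strict ∘ path n₀) (ℕₚ.<⇒<′ i<j)) xᵢ≲xⱼ

    decreasing-wellFounded : Acc _ChildOf_ []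
    decreasing-wellFounded with em {Acc _ChildOf_ []}
    ... | yes q = q
    ... | no ¬q with escape [] ¬q
    ...   | x , d , ¬q′ = ⊥-elim (no-path (x , [] , d , ¬q′))

    height : Ord (c ⊔ ℓ₂)
    height = rank decreasing-wellFounded

------------------------------------------------------------------------
-- Finite subsets under the Hoare embedding
--
-- A finite subset is represented by a list of its elements, and lists
-- with the same elements are identified.

module _ (A : Preorder c ℓ₁ ℓ₂) where
  open Preorder A using (Carrier; _≲_; reflexive; module Eq)
  open Subset Eq.setoid using (_⊆_)

  infix 4 _≤ᴴ_

  _≤ᴴ_ : Rel (List Carrier) (c ⊔ ℓ₂)
  S ≤ᴴ S′ = All (λ a → Any (λ b → a ≲ b) S′) S

  private
    ⊆⇒≤ᴴ : ∀ S {S′} → S ⊆ S′ → S ≤ᴴ S′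
    ⊆⇒≤ᴴ []      S⊆S′ = []
    ⊆⇒≤ᴴ (x ∷ S) S⊆S′ =
      Any.map reflexive (S⊆S′ (here Eq.refl)) ∷ ⊆⇒≤ᴴ S (S⊆S′ ∘ there)

    lift : ∀ {x S S′} → Any (x ≲_) S → S ≤ᴴ S′ → Any (x ≲_) S′
    lift (here x≲y) (y≤S′ ∷ _) = Any.map (Preorder.trans A x≲y) y≤S′
    lift (there x∈) (_ ∷ S≤S′) = lift x∈ S≤S′

  Pf : Preorder c (c ⊔ ℓ₁) (c ⊔ ℓ₂)
  Pf = record
    { Carrier    = List Carrier
    ; _≈_        = λ S S′ → (S ⊆ S′) × (S′ ⊆ S)
    ; _≲_        = _≤ᴴ_
    ; isPreorder = record
      { isEquivalence = record
        { refl  = id , id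
        ; sym   = λ (p , q) → q , p
        ; trans = λ (p , q) (p′ , q′) → (λ z → p′ (p z)) , (λ z → q (q′ z))
        }
      ; reflexive = λ {S} (p , _) → ⊆⇒≤ᴴ S p
      ; trans     = λ p q → All.map (λ z → lift z q) p
      }
    }

  -- Given a bad sequence of finite subsets, repeatedly pick an element of
  -- the first subset that lies below no element of infinitely many later
  -- ones, and pass to those; the picked elements form a bad sequence in A.

  module _ (em : ExcludedMiddle (c ⊔ ℓ₂)) where

    private
      _≰_ : Carrier → List Carrier → Set (c ⊔ ℓ₂)
      a ≰ S = ¬ Any (a ≲_) S

      Increasing : (ℕ → ℕ) → Set
      Increasing φ = ∀ {m n} → m ℕ.< n → φ m ℕ.< φ n

      increasing : (φ : ℕ → ℕ) → (∀ n → φ n ℕ.< φ (suc n)) → Increasing φ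
      increasing φ s m<n = go (ℕₚ.<⇒<′ m<n)
        where
        go : ∀ {m n} → m ℕ.<′ n → φ m ℕ.< φ n
        go ℕ.<′-base     = s _
        go (ℕ.<′-step q) = ℕₚ.<-trans (go q) (s _)

      not-all : ∀ {S S′} → ¬ (S ≤ᴴ S′) → Any (_≰ S′) S
      not-all {[]}    ¬q = ⊥-elim (¬q [])
      not-all {x ∷ S} {S′} ¬q with em {Any (x ≲_) S′}
      ... | yes r = there (not-all λ q → ¬q (r ∷ q))
      ... | no ¬r = here (λ r → ¬r r)

      pigeonhole : ∀ S (U : ℕ → List Carrier) → (∀ n → Any (_≰ U n) S) →
                   ∃₂ λ a φ → Any (a ≡_) S × Increasing φ × ∀ n → a ≰ U (φ n)
      pigeonhole []      U h with h 0
      ... | ()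
      pigeonhole (x ∷ S) U h
        with em {∃ λ N → ∀ n → Any (x ≲_) (U (N ℕ.+ n))}
      ... | yes (N , e) =
            let a , φ , a∈S , inc , av = pigeonhole S (λ n → U (N ℕ.+ n)) tail-hits
            in  a , (λ n → N ℕ.+ φ n) , there a∈S , (λ q → ℕₚ.+-monoʳ-< N (inc q)) , av
        where
        tail-hits : ∀ n → Any (_≰ U (N ℕ.+ n)) S
        tail-hits n with h (N ℕ.+ n)
        ... | here ¬q = ⊥-elim (¬q (e n))
        ... | there q = q
      ... | no ¬e = x , φ , here refl , increasing φ φ-step , φ-avoids
        where
        next : ∀ N → ∃ λ n → x ≰ U (N ℕ.+ n)
        next N with em {∃ λ n → x ≰ U (N ℕ.+ n)}
        ... | yes q = q
        ... | no ¬q = ⊥-elim (¬e (N , all))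
          where
          all : ∀ n → Any (x ≲_) (U (N ℕ.+ n))
          all n with em {Any (x ≲_) (U (N ℕ.+ n))}
          ... | yes r = r
          ... | no ¬r = ⊥-elim (¬q (n , ¬r))
        φ : ℕ → ℕ
        φ zero    = proj₁ (next 0)
        φ (suc n) = suc (φ n) ℕ.+ proj₁ (next (suc (φ n)))
        φ-step : ∀ n → φ n ℕ.< φ (suc n)
        φ-step n = s≤s (ℕₚ.m≤m+n (φ n) _)
        φ-avoids : ∀ n → x ≰ U (φ n)
        φ-avoids zero    = proj₂ (next 0)
        φ-avoids (suc n) = proj₂ (next (suc (φ n)))

      BadSeq : Set (c ⊔ ℓ₂)
      BadSeq = Σ (ℕ → List Carrier) λ U → ∀ {i j} → i ℕ.< j → ¬ (U i ≤ᴴ U j)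

      module _ (B : BadSeq) where
        private
          U : ℕ → List Carrier
          U = proj₁ B

          pick : ∃₂ λ a φ → Any (a ≡_) (U 0) × Increasing φ × ∀ n → a ≰ U (suc (φ n))
          pick = pigeonhole (U 0) (U ∘ suc) λ n → not-all (proj₂ B (s≤s z≤n))

        elt : Carrier
        elt = proj₁ pick

        φ : ℕ → ℕ
        φ = proj₁ (proj₂ pick)

        elt∈ : Any (elt ≡_) (U 0)
        elt∈ = proj₁ (proj₂ (proj₂ pick))

        thin : BadSeq
        thin = U ∘ suc ∘ φ , λ q → proj₂ B (s≤s (proj₁ (proj₂ (proj₂ (proj₂ pick))) q))

        elt≰ : ∀ n → elt ≰ proj₁ thin n
        elt≰ = proj₂ (proj₂ (proj₂ (proj₂ pick)))

      iter : BadSeq → ℕ → BadSeq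
      iter B zero    = B
      iter B (suc n) = iter (thin B) n

      sub : ∀ B n k → ∃ λ l → proj₁ (iter B n) k ≡ proj₁ B l
      sub B zero    k = k , refl
      sub B (suc n) k = let l , e = sub (thin B) n k in suc (φ B l) , e

      no-good : ∀ B {i j} → i ℕ.< j → ¬ (elt (iter B i) ≲ elt (iter B j))
      no-good B {zero}  {suc j} _ q =
        let l , e = sub (thin B) j 0
        in  elt≰ B l (subst (Any (elt B ≲_)) e
              (Any.map (λ {refl → q}) (elt∈ (iter B (suc j)))))
      no-good B {suc i} {suc j} (s≤s i<j) q = no-good (thin B) i<j q

    Pf-isWQO : IsWQO A → IsWQO Pf
    Pf-isWQO wqo U with em {∃₂ λ i j → i ℕ.< j × U i ≤ᴴ U j}
    ... | yes q = q
    ... | no ¬q =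
      let B = U , λ {i} {j} i<j r → ¬q (i , j , i<j , r)
          i , j , i<j , r = wqo (λ n → elt (iter B n))
      in  ⊥-elim (no-good B i<j r)

-- Write r for the rank of an element.  In a wqo the elements of rank exactly β
-- fall into finitely many equivalence classes, as they would otherwise contain
-- an infinite antichain.  Hence in a strictly decreasing sequence of finite
-- subsets of { x ∣ r x ≤ β } the top level can change only finitely often, and
-- between two changes the part not covered by the top level decreases strictly
-- in Pf { x ∣ r x < β }.  So passing from β to β + 1 multiplies the height
-- of Pf by a finite factor only.  At a limit λ each finite subset of
-- { x ∣ r x < λ } lies in some { x ∣ r x < β } with β < λ, and the finite
-- factors are absorbed because 2 ^ β · n ≤ 2 ^ λ.

module Submission where

open import Defs
open import Axiom.ExcludedMiddle using (ExcludedMiddle)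
open import Data.Empty using (⊥-elim)
open import Data.List.Base using (List; []; _∷_; length; filter)
open import Data.List.Properties using (length-filter)
open import Data.List.Membership.Propositional using (_∈_; find; lose)
open import Data.List.Membership.Propositional.Properties using (∈-filter⁺; ∈-filter⁻)
open import Data.List.Relation.Unary.All as All using (All; []; _∷_)
open import Data.List.Relation.Unary.Any as Any using (Any; here; there)
open import Data.List.Relation.Unary.Linked using ([-]; _∷_)
open import Data.Nat.Base as ℕ using (ℕ; zero; suc; s≤s; z≤n)
import Data.Nat.Properties as ℕₚ
open import Data.Product using (Σ; ∃; _×_; _,_; proj₁; proj₂)
open import Data.Sum.Base using (_⊎_; inj₁; inj₂)
open import Function.Base using (_∘_)
open import Induction.WellFounded using (Acc; acc; WellFounded)
open import Level using (Level; _⊔_; Lift; lift; lower)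
open import Relation.Binary.Bundles using (Preorder)
open import Relation.Binary.PropositionalEquality using (refl)
open import Relation.Nullary using (Dec; yes; no; ¬_; ¬?)
open import Relation.Nullary.Decidable using (map′)
open import Relation.Unary using (Pred; Decidable)

private
  variable
    a p q c ℓ ℓ₁ ℓ₂ : Level

-- Ordinals

private
  variable
    α β γ δ : Ord ℓ

≤ₒ-refl : (α : Ord ℓ) → α ≤ₒ α
≤ₒ-refl (sup⁺ I f) i = i , ≤ₒ-refl (f i)

≤ₒ-trans : α ≤ₒ β → β ≤ₒ γ → α ≤ₒ γ
≤ₒ-trans {α = sup⁺ _ _} {sup⁺ _ _} {sup⁺ _ _} α≤β β≤γ i =
  let j , f≤g = α≤β i
      k , g≤h = β≤γ j
  in  k , ≤ₒ-trans f≤g g≤h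

<ₒ-≤ₒ-trans : α <ₒ β → β ≤ₒ γ → α <ₒ γ
<ₒ-≤ₒ-trans {β = sup⁺ _ _} {sup⁺ _ _} (j , α≤g) β≤γ =
  let k , g≤h = β≤γ j in k , ≤ₒ-trans α≤g g≤h

≤ₒ-<ₒ-trans : α ≤ₒ β → β <ₒ γ → α <ₒ γ
≤ₒ-<ₒ-trans {γ = sup⁺ _ _} α≤β (k , β≤h) = k , ≤ₒ-trans α≤β β≤h

<ₒ⇒≤ₒ : α <ₒ β → α ≤ₒ β
<ₒ⇒≤ₒ {α = sup⁺ _ _} {sup⁺ _ _} (j , α≤g) i = j , <ₒ⇒≤ₒ (α≤g i)

<ₒ-irrefl : (α : Ord ℓ) → ¬ (α <ₒ α)
<ₒ-irrefl (sup⁺ I f) (i , α≤f) = <ₒ-irrefl (f i) (α≤f i)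

zeroₒ-least : zeroₒ ≤ₒ α
zeroₒ-least ()

-- If no `f i` reaches `β`, then every `f i` is below `β`: otherwise, by recursion, each `g j` is
-- below that `f i`, so `β ≤ₒ f i` after all.
≰ₒ⇒>ₒ : ExcludedMiddle ℓ → {α β : Ord ℓ} → ¬ (α ≤ₒ β) → β <ₒ α
≰ₒ⇒>ₒ em {sup⁺ I f} {sup⁺ J g} α≰β with em {Σ I λ i → sup⁺ J g ≤ₒ f i}
... | yes β<α = β<α
... | no  β≮α = ⊥-elim (α≰β below<)
  where
  below< : sup⁺ I f ≤ₒ sup⁺ J g
  below< i with em {f i <ₒ sup⁺ J g}
  ... | yes f<β = f<β
  ... | no  f≮β = ⊥-elim (β≮α (i , λ j → ≰ₒ⇒>ₒ em λ f≤g → f≮β (j , f≤g)))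

below-< : (α : Ord ℓ) (i : Index α) → below α i <ₒ α
below-< (sup⁺ I f) i = i , ≤ₒ-refl (f i)

below-≤ : (∀ i → below α i <ₒ β) → α ≤ₒ β
below-≤ {α = sup⁺ _ _} f<β = f<β

⨆-least : ∀ {I} (f : I → Ord ℓ) → (∀ i → f i ≤ₒ γ) → ⨆ I f ≤ₒ γ
⨆-least f f≤γ (i , k) = <ₒ-≤ₒ-trans (below-< (f i) k) (f≤γ i)

⨆-upper : ∀ {I} (f : I → Ord ℓ) i → f i ≤ₒ ⨆ I f
⨆-upper f i = below-≤ λ k → (i , k) , ≤ₒ-refl (below (f i) k)

maxₒ-least : (α β : Ord ℓ) → α ≤ₒ γ → β ≤ₒ γ → maxₒ α β ≤ₒ γ
maxₒ-least α β α≤γ β≤γ (inj₁ i) = <ₒ-≤ₒ-trans (below-< α i) α≤γ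
maxₒ-least α β α≤γ β≤γ (inj₂ j) = <ₒ-≤ₒ-trans (below-< β j) β≤γ

maxₒ-upperˡ : (α β : Ord ℓ) → α ≤ₒ maxₒ α β
maxₒ-upperˡ α β = below-≤ λ i → inj₁ i , ≤ₒ-refl (below α i)

maxₒ-upperʳ : (α β : Ord ℓ) → β ≤ₒ maxₒ α β
maxₒ-upperʳ α β = below-≤ λ j → inj₂ j , ≤ₒ-refl (below β j)

+ₒ-upperˡ : (α β : Ord ℓ) → α ≤ₒ α +ₒ β
+ₒ-upperˡ α (sup⁺ J g) = maxₒ-upperˡ α (sup⁺ J λ j → α +ₒ g j)

+ₒ-least : (α β : Ord ℓ) → α ≤ₒ γ → (∀ i → α +ₒ below β i <ₒ γ) → α +ₒ β ≤ₒ γ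
+ₒ-least α (sup⁺ J g) α≤γ <γ = maxₒ-least α (sup⁺ J λ j → α +ₒ g j) α≤γ <γ

+ₒ-monoʳ-< : β <ₒ γ → α +ₒ β <ₒ α +ₒ γ
+ₒ-monoʳ-≤ : β ≤ₒ γ → α +ₒ β ≤ₒ α +ₒ γ

+ₒ-monoʳ-< {γ = sup⁺ _ _} (k , β≤h) = inj₂ k , +ₒ-monoʳ-≤ β≤h

+ₒ-monoʳ-≤ {β = sup⁺ J g} {γ = γ} {α} β≤γ =
  +ₒ-least α (sup⁺ J g) (+ₒ-upperˡ _ γ) λ j → +ₒ-monoʳ-< (β≤γ j)

+ₒ-monoˡ-≤ : (γ : Ord ℓ) → α ≤ₒ β → α +ₒ γ ≤ₒ β +ₒ γ
+ₒ-monoˡ-≤ {α = α} {β} (sup⁺ K h) α≤β =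
  +ₒ-least α (sup⁺ K h) (≤ₒ-trans α≤β (+ₒ-upperˡ β (sup⁺ K h))) λ k → inj₂ k , +ₒ-monoˡ-≤ (h k) α≤β

+ₒ-upperʳ : (α β : Ord ℓ) → β ≤ₒ α +ₒ β
+ₒ-upperʳ α (sup⁺ J g) j = inj₂ j , +ₒ-upperʳ α (g j)

+ₒ-assoc-≤ : (α β γ : Ord ℓ) → α +ₒ (β +ₒ γ) ≤ₒ (α +ₒ β) +ₒ γ
+ₒ-assoc-≤ α β (sup⁺ K h) =
  +ₒ-least α (β +ₒ sup⁺ K h) (≤ₒ-trans (+ₒ-upperˡ α β) (+ₒ-upperˡ (α +ₒ β) (sup⁺ K h)))
    λ { (inj₁ j) → <ₒ-≤ₒ-trans (+ₒ-monoʳ-< (below-< β j)) (+ₒ-upperˡ (α +ₒ β) (sup⁺ K h))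
      ; (inj₂ k) → inj₂ k , +ₒ-assoc-≤ α β (h k) }

·ₒ-suc-≤ : (α : Ord ℓ) (n : ℕ) → α ·ₒ fromℕ (suc n) ≤ₒ α ·ₒ fromℕ n +ₒ α
·ₒ-suc-≤ α n = ⨆-least (λ _ → α ·ₒ fromℕ n +ₒ α) λ _ → ≤ₒ-refl _

·ₒ-suc-≥ : (α : Ord ℓ) (n : ℕ) → α ·ₒ fromℕ n +ₒ α ≤ₒ α ·ₒ fromℕ (suc n)
·ₒ-suc-≥ α n = ⨆-upper (λ _ → α ·ₒ fromℕ n +ₒ α) _

·ₒ-one-≥ : (α : Ord ℓ) → α ≤ₒ α ·ₒ fromℕ 1
·ₒ-one-≥ α = ≤ₒ-trans (+ₒ-upperʳ _ α) (·ₒ-suc-≥ α 0)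

·ₒ-monoˡ-≤ : ∀ n → α ≤ₒ β → α ·ₒ fromℕ n ≤ₒ β ·ₒ fromℕ n
·ₒ-monoˡ-≤ zero    α≤β = λ ()
·ₒ-monoˡ-≤ {α = α} {β} (suc n) α≤β =
  ≤ₒ-trans (·ₒ-suc-≤ α n)
  (≤ₒ-trans (+ₒ-monoˡ-≤ α (·ₒ-monoˡ-≤ n α≤β))
  (≤ₒ-trans (+ₒ-monoʳ-≤ α≤β) (·ₒ-suc-≥ β n)))

·ₒ-monoʳ-≤ : ∀ (α : Ord ℓ) {m n} → m ℕ.≤ n → α ·ₒ fromℕ m ≤ₒ α ·ₒ fromℕ n
·ₒ-monoʳ-≤ α z≤n = λ ()
·ₒ-monoʳ-≤ α {suc m} {suc n} (s≤s m≤n) =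
  ≤ₒ-trans (·ₒ-suc-≤ α m)
  (≤ₒ-trans (+ₒ-monoˡ-≤ α (·ₒ-monoʳ-≤ α m≤n)) (·ₒ-suc-≥ α n))

-- The order `n ℕ.+ m` lets the bound unfold along the induction on `n`, and lets it agree with the
-- unfolding of `suc h ℕ.* m` later.
·ₒ-distribˡ-≤ : (α : Ord ℓ) (m n : ℕ) →
                α ·ₒ fromℕ m +ₒ α ·ₒ fromℕ n ≤ₒ α ·ₒ fromℕ (n ℕ.+ m)
·ₒ-distribˡ-≤ α m zero    = +ₒ-least (α ·ₒ fromℕ m) (α ·ₒ fromℕ 0) (≤ₒ-refl _) λ ()
·ₒ-distribˡ-≤ α m (suc n) =
  ≤ₒ-trans (+ₒ-monoʳ-≤ (·ₒ-suc-≤ α n))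
  (≤ₒ-trans (+ₒ-assoc-≤ _ _ α)
  (≤ₒ-trans (+ₒ-monoˡ-≤ α (·ₒ-distribˡ-≤ α m n)) (·ₒ-suc-≥ α (n ℕ.+ m))))

oneₒ≤2^ : (α : Ord ℓ) → oneₒ ≤ₒ 2^ α
oneₒ≤2^ (sup⁺ J g) = maxₒ-upperˡ oneₒ (⨆ J λ j → 2^ (g j) ·ₒ fromℕ 2)

2^-positive : (α : Ord ℓ) → zeroₒ <ₒ 2^ α
2^-positive α = <ₒ-≤ₒ-trans (_ , ≤ₒ-refl zeroₒ) (oneₒ≤2^ α)

2^-mono-≤ : (α β : Ord ℓ) → α ≤ₒ β → 2^ α ≤ₒ 2^ β
2^-mono-< : (α β : Ord ℓ) → α <ₒ β → 2^ α ·ₒ fromℕ 2 ≤ₒ 2^ β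

2^-mono-≤ (sup⁺ I f) β α≤β =
  maxₒ-least oneₒ (⨆ I 2^f·2) (oneₒ≤2^ β) (⨆-least 2^f·2 λ i → 2^-mono-< (f i) β (α≤β i))
  where
  2^f·2 = λ i → 2^ (f i) ·ₒ fromℕ 2

2^-mono-< α (sup⁺ J g) (j , α≤g) =
  ≤ₒ-trans (·ₒ-monoˡ-≤ 2 (2^-mono-≤ α (g j) α≤g))
  (≤ₒ-trans (⨆-upper 2^g·2 j) (maxₒ-upperʳ oneₒ (⨆ J 2^g·2)))
  where
  2^g·2 = λ j → 2^ (g j) ·ₒ fromℕ 2

-- Absorption of finite factors at a limit

module _ {I : Set ℓ} (f : I → Ord ℓ) (unbounded : ∀ i → ∃ λ j → f i <ₒ f j) where

  -- Each strict step up the family at least doubles the power, so `n` steps absorb the factor `n`.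
  -- The inequality `f i ≤ₒ f j` is carried along to bound the next summand.
  2^-multiples : ∀ n i → ∃ λ j → f i ≤ₒ f j × 2^ (f i) ·ₒ fromℕ n ≤ₒ 2^ (f j)
  2^-multiples zero    i = i , ≤ₒ-refl (f i) , λ ()
  2^-multiples (suc n) i =
    let j , fi≤fj , ih = 2^-multiples n i
        k , fj<fk      = unbounded j
    in  k , ≤ₒ-trans fi≤fj (<ₒ⇒≤ₒ fj<fk) ,
        ≤ₒ-trans (·ₒ-suc-≤ (2^ (f i)) n)
        (≤ₒ-trans (+ₒ-monoˡ-≤ (2^ (f i)) (≤ₒ-trans ih (·ₒ-one-≥ (2^ (f j)))))
        (≤ₒ-trans (+ₒ-monoʳ-≤ (2^-mono-≤ (f i) (f j) fi≤fj))
        (≤ₒ-trans (·ₒ-suc-≥ (2^ (f j)) 1) (2^-mono-< (f j) (f k) fj<fk))))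

  2^-absorbs : ∀ n i → 2^ (f i) ·ₒ fromℕ n ≤ₒ 2^ (sup⁺ I f)
  2^-absorbs n i =
    let j , _ , ≤2^ = 2^-multiples n i
    in  ≤ₒ-trans ≤2^ (2^-mono-≤ (f j) (sup⁺ I f) (<ₒ⇒≤ₒ (j , ≤ₒ-refl (f j))))

-- Counting list entries under nested predicates

module _ {A : Set a} {P : Pred A p} {Q : Pred A q}
         (P? : Decidable P) (Q? : Decidable Q) (P⊆Q : ∀ {x} → P x → Q x) where

  -- An entry satisfying `Q` but not `P` lengthens only the second filter; without such an entry the
  -- two predicates agree on `xs`.
  filter-⊆-dichotomy : ∀ xs → length (filter P? xs) ℕ.≤ length (filter Q? xs) ×
    (length (filter P? xs) ℕ.< length (filter Q? xs) ⊎ All (λ x → Q x → P x) xs)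
  filter-⊆-dichotomy [] = z≤n , inj₂ []
  filter-⊆-dichotomy (x ∷ xs) with P? x | Q? x | filter-⊆-dichotomy xs
  ... | yes px | yes _  | le , inj₁ lt = s≤s le , inj₁ (s≤s lt)
  ... | yes px | yes _  | le , inj₂ eq = s≤s le , inj₂ ((λ _ → px) ∷ eq)
  ... | yes px | no ¬qx | _            = ⊥-elim (¬qx (P⊆Q px))
  ... | no _   | yes _  | le , _       = ℕₚ.m≤n⇒m≤1+n le , inj₁ (s≤s le)
  ... | no _   | no ¬qx | le , inj₁ lt = le , inj₁ lt
  ... | no _   | no ¬qx | le , inj₂ eq = le , inj₂ ((λ qx → ⊥-elim (¬qx qx)) ∷ eq)

-- Ranks of elements

module Rank (A : Preorder c ℓ₁ ℓ₂) where
  open Preorder A using (Carrier; _≲_) renaming (trans to ≲-trans; refl to ≲-refl)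
  open Tree (Decreasing A)

  private
    _<_ : Carrier → Carrier → Set ℓ₂
    _<_ = Strict A

  <-≲-trans : ∀ {x y z} → x < y → y ≲ z → x < z
  <-≲-trans (x≲y , y≴x) y≲z = ≲-trans x≲y y≲z , λ z≲x → y≴x (≲-trans y≲z z≲x)

  -- Rank in the strict order itself. A tree node `x ∷ s` has the same rank for every `s`, since its
  -- possible extensions depend only on `x`.
  accRank : ∀ {x} → Acc _<_ x → Ord (c ⊔ ℓ₂)
  accRank {x} (acc rs) = sup⁺ (∃ λ y → y < x) λ (y , y<x) → accRank (rs y<x)

  -- Whatever is strictly below `x` is strictly below `y`. Applied to `≲-refl`, this also shows that
  -- the rank does not depend on the accessibility proof.
  accRank-mono : ∀ {x y} (u : Acc _<_ x) (v : Acc _<_ y) → x ≲ y → accRank u ≤ₒ accRank v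
  accRank-mono (acc u) (acc v) x≲y (z , z<x) =
    (z , <-≲-trans z<x x≲y) , accRank-mono (u z<x) (v (<-≲-trans z<x x≲y)) ≲-refl

  acc-head : ∀ {x s} → Decreasing A (x ∷ s) → Acc _ChildOf_ (x ∷ s) → Acc _<_ x
  acc-head d (acc rs) = acc λ y<x → acc-head (y<x ∷ d) (rs (_ , refl , y<x ∷ d))

  accRank≤rank : ∀ {x s} → Decreasing A (x ∷ s) → (u : Acc _<_ x) (v : Acc _ChildOf_ (x ∷ s)) →
                 accRank u ≤ₒ rank v
  accRank≤rank d (acc u) (acc v) (y , y<x) = (y , y<x ∷ d) , accRank≤rank (y<x ∷ d) (u y<x) _

  rank≤accRank : ∀ {x s} (u : Acc _<_ x) (v : Acc _ChildOf_ (x ∷ s)) → rank v ≤ₒ accRank u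
  rank≤accRank (acc u) (acc v) (y , y<x ∷ _) = (y , y<x) , rank≤accRank (u y<x) _

  module _ (wf : WellFounded _<_) where

    accRank<rank-root : (v : Acc _ChildOf_ []) → ∀ x → accRank (wf x) <ₒ rank v
    accRank<rank-root (acc v) x = (x , [-]) , accRank≤rank [-] (wf x) _

    rank-root≤ : (v : Acc _ChildOf_ []) → (∀ x → accRank (wf x) <ₒ γ) → rank v ≤ₒ γ
    rank-root≤ (acc v) <γ (x , _) = ≤ₒ-<ₒ-trans (rank≤accRank (wf x) _) (<γ x)

  module _ (em : ExcludedMiddle (c ⊔ ℓ₂)) (wqo : IsWQO A) where

    strict-wellFounded : WellFounded _<_
    strict-wellFounded x with decreasing-wellFounded A em wqo
    ... | acc rs = acc-head [-] (rs (x , refl , [-]))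

    rk : Carrier → Ord (c ⊔ ℓ₂)
    rk x = accRank (strict-wellFounded x)

    rk-mono-≤ : ∀ {x y} → x ≲ y → rk x ≤ₒ rk y
    rk-mono-≤ = accRank-mono _ _

    rk-mono-< : ∀ {x y} → x < y → rk x <ₒ rk y
    rk-mono-< {x} {y} x<y with strict-wellFounded y
    ... | acc rs = (x , x<y) , accRank-mono _ _ ≲-refl

    rk-least : ∀ {x} → (∀ {y} → y < x → rk y <ₒ γ) → rk x ≤ₒ γ
    rk-least {x = x} <γ with strict-wellFounded x
    ... | acc rs = λ (y , y<x) → ≤ₒ-<ₒ-trans (accRank-mono _ _ ≲-refl) (<γ y<x)

    rk<height : ∀ x → rk x <ₒ height A em wqo
    rk<height = accRank<rank-root strict-wellFounded _

    height≤ : (∀ x → rk x <ₒ γ) → height A em wqo ≤ₒ γ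
    height≤ = rank-root≤ strict-wellFounded _

    -- Finiteness of each rank level

    _≲?_ : ∀ x y → Dec (x ≲ y)
    x ≲? y = map′ lower lift (em {Lift c (x ≲ y)})

    -- Otherwise `x` would be strictly below `y` and have smaller rank. Hence comparable elements of
    -- one level are equivalent.
    ≲-rk-≥⇒≳ : ∀ {x y} → x ≲ y → rk y ≤ₒ rk x → y ≲ x
    ≲-rk-≥⇒≳ {x} {y} x≲y ry≤rx with y ≲? x
    ... | yes y≲x = y≲x
    ... | no  y≴x = ⊥-elim (<ₒ-irrefl (rk x) (<ₒ-≤ₒ-trans (rk-mono-< (x≲y , y≴x)) ry≤rx))

    module _ (β : Ord (c ⊔ ℓ₂)) where

      Represented : List Carrier → Carrier → Set (c ⊔ ℓ₂)
      Represented L x = Any (λ l → x ≲ l × l ≲ x) L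

      AtLevel : Carrier → Set (c ⊔ ℓ₂)
      AtLevel x = β ≤ₒ rk x × rk x ≤ₒ β

      -- Otherwise one can forever choose elements of the level equivalent to no earlier choice. The
      -- wqo property makes two of them comparable, and equal rank then makes them equivalent.
      level-finite : ∃ λ L → ∀ x → AtLevel x → Represented L x
      level-finite with em {∃ λ L → ∀ x → AtLevel x → Represented L x}
      ... | yes q = q
      ... | no ¬q = ⊥-elim (no-sequence (wqo elt))
        where
        new : ∀ L → ∃ λ x → AtLevel x × ¬ Represented L x
        new L with em {∃ λ x → AtLevel x × ¬ Represented L x}
        ... | yes n = n
        ... | no ¬n = ⊥-elim (¬q (L , represented))
          where
          represented : ∀ x → AtLevel x → Represented L x
          represented x x∈β with em {Represented L x}
          ... | yes r = r
          ... | no ¬r = ⊥-elim (¬n (x , x∈β , ¬r))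

        prefix : ℕ → List Carrier
        prefix zero    = []
        prefix (suc n) = proj₁ (new (prefix n)) ∷ prefix n

        elt : ℕ → Carrier
        elt n = proj₁ (new (prefix n))

        elt∈prefix : ∀ {i j} → i ℕ.<′ j → elt i ∈ prefix j
        elt∈prefix ℕ.<′-base     = here refl
        elt∈prefix (ℕ.<′-step q) = there (elt∈prefix q)

        no-sequence : ¬ (∃ λ i → ∃ λ j → i ℕ.< j × elt i ≲ elt j)
        no-sequence (i , j , i<j , xᵢ≲xⱼ) =
          let _ , (β≤rᵢ , _) , _    = new (prefix i)
              _ , (_ , rⱼ≤β) , ¬rep = new (prefix j)
          in  ¬rep (lose (elt∈prefix (ℕₚ.<⇒<′ i<j))
                         (≲-rk-≥⇒≳ xᵢ≲xⱼ (≤ₒ-trans rⱼ≤β β≤rᵢ) , xᵢ≲xⱼ))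

-- Heights of powersets

module _ (em : ExcludedMiddle (c ⊔ ℓ₂)) (A : Preorder c ℓ₁ ℓ₂) (wqo : IsWQO A) where
  open Preorder A using (Carrier; _≲_) renaming (trans to ≲-trans; refl to ≲-refl)

  private
    module R  = Rank A
    module Rᴾ = Rank (Pf A)

    _≤_ : List Carrier → List Carrier → Set (c ⊔ ℓ₂)
    _≤_ = _≤ᴴ_ A

    rk : Carrier → Ord (c ⊔ ℓ₂)
    rk = R.rk em wqo

    rkᴾ : List Carrier → Ord (c ⊔ ℓ₂)
    rkᴾ = Rᴾ.rk em (Pf-isWQO A em wqo)

    ≤-find : ∀ {S T x} → S ≤ T → x ∈ S → ∃ λ y → y ∈ T × x ≲ y
    ≤-find S≤T x∈S = find (All.lookup S≤T x∈S)

    ≤-intro : ∀ {S T} → (∀ {x} → x ∈ S → ∃ λ y → y ∈ T × x ≲ y) → S ≤ T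
    ≤-intro h = All.tabulate λ x∈S → let y , y∈T , x≲y = h x∈S in lose y∈T x≲y

  -- Taking singletons is strictly monotone, and the empty set, strictly below every singleton,
  -- supplies the extra 1 on the left.
  rk-singleton : ∀ {x} → Acc (Strict A) x → oneₒ +ₒ rk x ≤ₒ rkᴾ (x ∷ [])
  rk-singleton {x} (acc rs) with R.strict-wellFounded em wqo x
  ... | acc _ = +ₒ-least oneₒ _
    (λ _ → ≤ₒ-<ₒ-trans zeroₒ-least
             (Rᴾ.rk-mono-< em (Pf-isWQO A em wqo) {[]} ([] , λ { (() ∷ _) })))
    λ { (y , y<x@(y≲x , x≴y)) →
        ≤ₒ-<ₒ-trans (≤ₒ-trans (+ₒ-monoʳ-≤ (R.accRank-mono _ _ ≲-refl)) (rk-singleton (rs y<x)))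
          (Rᴾ.rk-mono-< em (Pf-isWQO A em wqo)
            (here y≲x ∷ [] , λ { (here x≲y ∷ _) → x≴y x≲y })) }

  1+height≤height-Pf : oneₒ +ₒ height A em wqo ≤ₒ height (Pf A) em (Pf-isWQO A em wqo)
  1+height≤height-Pf with decreasing-wellFounded A em wqo
  ... | acc rs = +ₒ-least oneₒ _
    (λ _ → ≤ₒ-<ₒ-trans zeroₒ-least (Rᴾ.rk<height em (Pf-isWQO A em wqo) []))
    λ (x , _) → ≤ₒ-<ₒ-trans
      (≤ₒ-trans (+ₒ-monoʳ-≤ (R.rank≤accRank _ _))
                (rk-singleton (R.strict-wellFounded em wqo x)))
      (Rᴾ.rk<height em (Pf-isWQO A em wqo) (x ∷ []))

  -- E is to be 2 ^ β, so that E · m bounds the ranks of the finite subsets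
  -- living strictly below level β.

  module _ (β E : Ord (c ⊔ ℓ₂)) (m : ℕ)
           (bound : ∀ S → (∀ {x} → x ∈ S → rk x <ₒ β) → rkᴾ S <ₒ E ·ₒ fromℕ m) where

    private
      representatives : List Carrier
      representatives = proj₁ (R.level-finite em wqo β)

      -- The top level of `S` consists of its elements of rank at least `β`; whatever lies below one
      -- of them is redundant in `S` for the Hoare order.
      Covered : List Carrier → Carrier → Set (c ⊔ ℓ₂)
      Covered S x = ∃ λ u → u ∈ S × β ≤ₒ rk u × x ≲ u

      covered? : ∀ S → Decidable (Covered S)
      covered? S x = em

      rest : List Carrier → List Carrier
      rest S = filter (¬? ∘ covered? S) S

      Hit : List Carrier → Carrier → Set (c ⊔ ℓ₂)
      Hit S l = Any (l ≲_) S

      hit? : ∀ S → Decidable (Hit S)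
      hit? S l = em

      -- Measures the top level. It is monotone for the Hoare order, so along a decreasing sequence
      -- it can drop only finitely often.
      hits : List Carrier → ℕ
      hits S = length (filter (hit? S) representatives)

      AtMost : List Carrier → Set (c ⊔ ℓ₂)
      AtMost S = ∀ {x} → x ∈ S → rk x ≤ₒ β

      AtMost-≤ : ∀ {S T} → T ≤ S → AtMost S → AtMost T
      AtMost-≤ T≤S S≤β t∈T =
        let s , s∈S , t≲s = ≤-find T≤S t∈T
        in  ≤ₒ-trans (R.rk-mono-≤ em wqo t≲s) (S≤β s∈S)

      rest-bound : ∀ S → rkᴾ (rest S) <ₒ E ·ₒ fromℕ m
      rest-bound S = bound (rest S) λ {x} x∈rest →
        let x∈S , uncovered = ∈-filter⁻ (¬? ∘ covered? S) x∈rest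
        in  ≰ₒ⇒>ₒ em λ β≤rx → uncovered (x , x∈S , β≤rx , ≲-refl)

      -- A top element `u` of `S` has rank exactly `β`, hence an equivalent representative. `S` hits
      -- it, so `T` does too, by some `t` above `u`.
      covered-transfer : ∀ {S T} → AtMost S → All (λ l → Hit S l → Hit T l) representatives →
                         ∀ {x} → Covered S x → Covered T x
      covered-transfer S≤β hits⊆ (u , u∈S , β≤ru , x≲u) =
        let l , l∈L , u≲l , l≲u = find (proj₂ (R.level-finite em wqo β) u (β≤ru , S≤β u∈S))
            t , t∈T , l≲t       = find (All.lookup hits⊆ l∈L (lose u∈S l≲u))
            u≲t                 = ≲-trans u≲l l≲t
        in  t , t∈T , ≤ₒ-trans β≤ru (R.rk-mono-≤ em wqo u≲t) , ≲-trans x≲u u≲t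

      -- With the top level unchanged, an element of `S` is covered in `T` as soon as it is covered
      -- in `S`, so the strict decrease must happen among the uncovered elements.
      rest-strict : ∀ {S T} → AtMost S → All (λ l → Hit S l → Hit T l) representatives →
                    Strict (Pf A) T S → Strict (Pf A) (rest T) (rest S)
      rest-strict {S} {T} S≤β hits⊆ (T≤S , S≰T) = ≤-intro to , λ rS≤rT → S≰T (≤-intro (from rS≤rT))
        where
        to : ∀ {t} → t ∈ rest T → ∃ λ s → s ∈ rest S × t ≲ s
        to t∈rest =
          let t∈T , uncovered = ∈-filter⁻ (¬? ∘ covered? T) t∈rest
              s , s∈S , t≲s   = ≤-find T≤S t∈T
          in  s , ∈-filter⁺ (¬? ∘ covered? S) s∈S (λ cov →
                    let u , u∈T , β≤ru , s≲u = covered-transfer S≤β hits⊆ cov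
                    in  uncovered (u , u∈T , β≤ru , ≲-trans t≲s s≲u)) , t≲s

        from : rest S ≤ rest T → ∀ {s} → s ∈ S → ∃ λ t → t ∈ T × s ≲ t
        from rS≤rT {s} s∈S with covered? S s
        ... | yes cov = let t , t∈T , _ , s≲t = covered-transfer S≤β hits⊆ cov in t , t∈T , s≲t
        ... | no ¬cov =
          let t , t∈rest , s≲t = ≤-find rS≤rT (∈-filter⁺ (¬? ∘ covered? S) s∈S ¬cov)
          in  t , proj₁ (∈-filter⁻ (¬? ∘ covered? T) t∈rest) , s≲t

      hits-rest-bound : ∀ S → E ·ₒ fromℕ (hits S ℕ.* m) +ₒ rkᴾ (rest S)
                              <ₒ E ·ₒ fromℕ (suc (hits S) ℕ.* m)
      hits-rest-bound S =
        <ₒ-≤ₒ-trans (+ₒ-monoʳ-< (rest-bound S)) (·ₒ-distribˡ-≤ E (hits S ℕ.* m) m)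

      -- The pair of `hits` and the rank of `rest` decreases lexicographically. If `hits` drops, the
      -- freed block `E ·ₒ fromℕ m` pays for any new `rest`; if not, `rest` itself drops.
      rk≤hits-rest : ∀ {S} → Acc (Strict (Pf A)) S → AtMost S →
                     rkᴾ S ≤ₒ E ·ₒ fromℕ (hits S ℕ.* m) +ₒ rkᴾ (rest S)
      rk≤hits-rest {S} (acc rs) S≤β = Rᴾ.rk-least em (Pf-isWQO A em wqo) smaller
        where
        smaller : ∀ {T} → Strict (Pf A) T S →
                  rkᴾ T <ₒ E ·ₒ fromℕ (hits S ℕ.* m) +ₒ rkᴾ (rest S)
        smaller {T} T<S@(T≤S , _)
          with filter-⊆-dichotomy (hit? T) (hit? S)
                 (λ hit → let t , t∈T , l≲t = find hit
                              s , s∈S , t≲s = ≤-find T≤S t∈T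
                          in  lose s∈S (≲-trans l≲t t≲s))
                 representatives
             | rk≤hits-rest (rs T<S) (AtMost-≤ T≤S S≤β)
        ... | _  , inj₁ lt   | ih =
          <ₒ-≤ₒ-trans (≤ₒ-<ₒ-trans ih (hits-rest-bound T))
          (≤ₒ-trans (·ₒ-monoʳ-≤ E (ℕₚ.*-monoˡ-≤ m lt)) (+ₒ-upperˡ _ _))
        ... | le , inj₂ same | ih =
          ≤ₒ-<ₒ-trans ih
          (<ₒ-≤ₒ-trans
            (+ₒ-monoʳ-< (Rᴾ.rk-mono-< em (Pf-isWQO A em wqo) (rest-strict S≤β same T<S)))
            (+ₒ-monoˡ-≤ _ (·ₒ-monoʳ-≤ E (ℕₚ.*-monoˡ-≤ m le))))

    successor-bound : ∃ λ n → ∀ S → (∀ {x} → x ∈ S → rk x ≤ₒ β) → rkᴾ S <ₒ E ·ₒ fromℕ n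
    -- `hits S` ranges from 0 to the number of representatives, and each value takes one block
    -- `E ·ₒ fromℕ m`.
    successor-bound = suc (length representatives) ℕ.* m , λ S S≤β →
      <ₒ-≤ₒ-trans
        (≤ₒ-<ₒ-trans (rk≤hits-rest (Rᴾ.strict-wellFounded em (Pf-isWQO A em wqo) S) S≤β)
                     (hits-rest-bound S))
        (·ₒ-monoʳ-≤ E (ℕₚ.*-monoˡ-≤ m (s≤s (length-filter (hit? S) representatives))))

  -- Induction on the bound for the ranks

  Below : Ord (c ⊔ ℓ₂) → List Carrier → Set (c ⊔ ℓ₂)
  Below α S = ∀ {x} → x ∈ S → rk x <ₒ α

  rkᴾ-empty : rkᴾ [] <ₒ 2^ α
  rkᴾ-empty {α = α} = ≤ₒ-<ₒ-trans
    (Rᴾ.rk-least em (Pf-isWQO A em wqo) λ (_ , []≰T) → ⊥-elim ([]≰T []))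
    (2^-positive α)

  -- The factor `m` is uniform in `S`, as a bound on the height requires. A largest member of the
  -- family makes `α` its successor; otherwise `α` is a limit, possibly zero.
  rk-bound : ∀ α → ∃ λ m → (∀ S → Below α S → rkᴾ S <ₒ 2^ α ·ₒ fromℕ m)
                         × (IsLimit α → ∀ S → Below α S → rkᴾ S <ₒ 2^ α)
  rk-bound (sup⁺ I f) with em {∃ λ i → ∀ j → f j ≤ₒ f i}
  ... | yes (i , max) =
    let m , bound , _ = rk-bound (f i)
        -- Rank below `α` now means rank at most `f i`.
        n , bound′    = successor-bound (f i) (2^ (f i)) m bound
    in  n ,
        (λ S S<α → <ₒ-≤ₒ-trans
          (bound′ S λ x∈S → let j , rx≤fj = S<α x∈S in ≤ₒ-trans rx≤fj (max j))
          (·ₒ-monoˡ-≤ n (2^-mono-≤ (f i) (sup⁺ I f) (<ₒ⇒≤ₒ (i , ≤ₒ-refl (f i)))))) ,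
        λ limit → ⊥-elim (limit (f i , (λ j → _ , max j) , λ _ → i , ≤ₒ-refl (f i)))
  ... | no ¬max =
    1 , (λ S S<α → <ₒ-≤ₒ-trans (limit-bound S S<α) (·ₒ-one-≥ (2^ (sup⁺ I f)))) ,
    λ _ → limit-bound
    where
    unbounded : ∀ i → ∃ λ j → f i <ₒ f j
    unbounded i with em {∃ λ j → f i <ₒ f j}
    ... | yes q = q
    ... | no ¬q = ⊥-elim (¬max (i , dominated))
      where
      dominated : ∀ j → f j ≤ₒ f i
      dominated j with em {f j ≤ₒ f i}
      ... | yes q = q
      ... | no ¬p = ⊥-elim (¬q (j , ≰ₒ⇒>ₒ em ¬p))

    -- Of two bounds from the family the larger serves for both, and `unbounded` makes it strict.
    -- The list is nonempty because an empty family has no index to offer.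
    common : ∀ x S → Below (sup⁺ I f) (x ∷ S) → ∃ λ i → Below (f i) (x ∷ S)
    common x [] S<α =
      let i , rx≤fi = S<α (here refl)
          j , fi<fj = unbounded i
      in  j , λ { (here refl) → ≤ₒ-<ₒ-trans rx≤fi fi<fj }
    common x (y ∷ S) S<α with common y S (S<α ∘ there) | S<α (here refl)
    ... | i , S<fi | j , rx≤fj with em {f i ≤ₒ f j}
    ...   | yes fi≤fj = let k , fj<fk = unbounded j in
      k , λ { (here refl)  → ≤ₒ-<ₒ-trans rx≤fj fj<fk
            ; (there y∈S) → <ₒ-≤ₒ-trans (S<fi y∈S) (≤ₒ-trans fi≤fj (<ₒ⇒≤ₒ fj<fk)) }
    ...   | no  fi≰fj =
      i , λ { (here refl)  → ≤ₒ-<ₒ-trans rx≤fj (≰ₒ⇒>ₒ em fi≰fj)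
            ; (there y∈S) → S<fi y∈S }

    limit-bound : ∀ S → Below (sup⁺ I f) S → rkᴾ S <ₒ 2^ (sup⁺ I f)
    -- The empty set is separate because it is the only finite subset left when `α` is zero; its
    -- rank 0 is below every power.
    limit-bound []      _   = rkᴾ-empty {α = sup⁺ I f}
    limit-bound (x ∷ S) S<α =
      let i , S<fi      = common x S S<α
          m , bound , _ = rk-bound (f i)
      in  <ₒ-≤ₒ-trans (bound (x ∷ S) S<fi) (2^-absorbs f unbounded m i)

mainTheorem2 : ∀ {c ℓ₁ ℓ₂} (em : ExcludedMiddle (c ⊔ ℓ₂)) (A : Preorder c ℓ₁ ℓ₂) (wqo : IsWQO A) →
    let hA = height A em wqo
        hP = height (Pf A) em (Pf-isWQO A em wqo)
    in ∃ λ (m : ℕ) →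
         (oneₒ +ₒ hA ≤ₒ hP)
         × (IsLimit hA → hP ≤ₒ 2^ hA)
         × (IsSuccessor hA → hP ≤ₒ 2^ hA ·ₒ fromℕ m)
mainTheorem2 em A wqo =
  let m , bound , limit-bound = rk-bound em A wqo (height A em wqo)
      height-Pf≤              = Rank.height≤ (Pf A) em (Pf-isWQO A em wqo)
      all-below S {x} x∈S     = Rank.rk<height A em wqo x
  in  m , 1+height≤height-Pf em A wqo
        , (λ limit → height-Pf≤ λ S → limit-bound limit S (all-below S))
        , (λ _ → height-Pf≤ λ S → bound S (all-below S))
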